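{- For every fixed integer $k\ge 4$, every randomized query algorithm that finds $k$ kings in $n$-vertex tournaments (i.e. that on every $n$-vertex tournament outputs, with probability at least $2/3$, a set of $k$ distinct kings if the tournament has at least $k$ kings, and $\bot$ otherwise) requires $\Omega(n^2)$ queries. That is, for every integer $k\ge 4$ there are constants $c>0$ and $n_0$ such that for all $n\ge n_0$ every such algorithm makes at least $cn^2$ queries in the worst case.
   Context: A tournament is a directed graph such that for every two distinct vertices $u,v$ exactly one of the edges $u\to v$, $v\to u$ is present. A vertex $v$ of a tournament is a king if for every other vertex $u$ there is a directed path from $v$ to $u$ of length (number of edges) at most $2$. Query model: the vertex set is known to the algorithm; each query specifies a pair of distinct vertices $u,v$, and the oracle answers whether $u\to v$ or $v\to u$. Only the number of queries is counted. A randomized query algorithm is a probability distribution over deterministic decision trees; its worst-case number of queries is the maximum over all inputs and all trees in the support of the number of queries made. -}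

module Defs where

open import Algebra.Bundles using (CommutativeMonoid)
import Algebra.Properties.CommutativeSemigroup as CommutativeSemigroup
open import Data.Bool using (Bool; true; false; not; if_then_else_)
open import Data.Bool.Properties using () renaming (_≟_ to _≟ᵇ_)
open import Data.Fin using (Fin)
import Data.Fin.Properties as Fin
open import Data.Fin.Subset using (Subset; _∈_; ∣_∣)
open import Data.Fin.Subset.Properties using (_∈?_)
open import Data.Integer using (+_)
open import Data.List using (allFin; filter; length)
open import Data.Maybe using (Maybe; just; nothing)
open import Data.Nat as ℕ using (ℕ; suc)
import Data.Nat.Properties as ℕ
open import Data.Product using (Σ; ∃; _×_; _,_)
open import Data.Rational as ℚ using (ℚ; 0ℚ; ½)
import Data.Rational.Properties as ℚ
open import Data.Sum using (_⊎_)
open import Data.Vec.Functional using (Vector; foldr)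
open import Level using (0ℓ)
open import Relation.Binary.PropositionalEquality using (_≡_; _≢_; sym; trans; cong; subst)
open import Relation.Nullary using (Dec; does; ¬?; _×-dec_; _⊎-dec_; _→-dec_)
open import Relation.Unary using (Pred; Decidable)

-- Real numbers, as Cauchy sequences of rationals.

Eventually : Pred ℕ 0ℓ → Set
Eventually P = ∃ λ N → ∀ n → N ℕ.≤ n → P n

record ℝ : Set where
  field
    seq    : ℕ → ℚ
    cauchy : ∀ ε → 0ℚ ℚ.< ε →
             ∃ λ N → ∀ m n → N ℕ.≤ m → N ℕ.≤ n → ℚ.∣ seq m ℚ.- seq n ∣ ℚ.≤ ε

open ℝ public

infix 4 _≃ᴿ_ _≤ᴿ_ _<ᴿ_

_≃ᴿ_ : ℝ → ℝ → Set
x ≃ᴿ y = ∀ ε → 0ℚ ℚ.< ε → Eventually λ n → ℚ.∣ seq x n ℚ.- seq y n ∣ ℚ.≤ ε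

_≤ᴿ_ : ℝ → ℝ → Set
x ≤ᴿ y = ∀ ε → 0ℚ ℚ.< ε → Eventually λ n → seq x n ℚ.≤ seq y n ℚ.+ ε

_<ᴿ_ : ℝ → ℝ → Set
x <ᴿ y = ∃ λ ε → 0ℚ ℚ.< ε × (Eventually λ n → seq x n ℚ.+ ε ℚ.≤ seq y n)

fromℚ : ℚ → ℝ
fromℚ q .seq _ = q
fromℚ q .cauchy ε 0<ε = 0 , λ _ _ _ _ →
  subst (λ r → ℚ.∣ r ∣ ℚ.≤ ε) (sym (ℚ.+-inverseʳ q)) (ℚ.<⇒≤ 0<ε)

private
  half-pos : ∀ {ε} → 0ℚ ℚ.< ε → 0ℚ ℚ.< ½ ℚ.* ε
  half-pos {ε} 0<ε = subst (ℚ._< ½ ℚ.* ε) (ℚ.*-zeroʳ ½) (ℚ.*-monoʳ-<-pos ½ 0<ε)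

  half+half : ∀ ε → ½ ℚ.* ε ℚ.+ ½ ℚ.* ε ≡ ε
  half+half ε = trans (sym (ℚ.*-distribʳ-+ ε ½ ½)) (ℚ.*-identityˡ ε)

  +-interchange : ∀ a b c d → (a ℚ.+ b) ℚ.+ (c ℚ.+ d) ≡ (a ℚ.+ c) ℚ.+ (b ℚ.+ d)
  +-interchange = CommutativeSemigroup.interchange
    (CommutativeMonoid.commutativeSemigroup ℚ.+-0-commutativeMonoid)

  +-interchange-minus : ∀ a b c d →
    (a ℚ.+ b) ℚ.- (c ℚ.+ d) ≡ (a ℚ.- c) ℚ.+ (b ℚ.- d)
  +-interchange-minus a b c d =
    trans (cong (λ r → (a ℚ.+ b) ℚ.+ r) (ℚ.neg-distrib-+ c d))
          (+-interchange a b (ℚ.- c) (ℚ.- d))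

infixl 6 _+ᴿ_

_+ᴿ_ : ℝ → ℝ → ℝ
(x +ᴿ y) .seq n = seq x n ℚ.+ seq y n
(x +ᴿ y) .cauchy ε 0<ε with cauchy x _ (half-pos 0<ε) | cauchy y _ (half-pos 0<ε)
... | M , hx | N , hy = M ℕ.⊔ N , λ m n M⊔N≤m M⊔N≤n → begin
  ℚ.∣ (seq x m ℚ.+ seq y m) ℚ.- (seq x n ℚ.+ seq y n) ∣
    ≡⟨ cong ℚ.∣_∣ (+-interchange-minus (seq x m) (seq y m) (seq x n) (seq y n)) ⟩
  ℚ.∣ (seq x m ℚ.- seq x n) ℚ.+ (seq y m ℚ.- seq y n) ∣
    ≤⟨ ℚ.∣p+q∣≤∣p∣+∣q∣ (seq x m ℚ.- seq x n) (seq y m ℚ.- seq y n) ⟩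
  ℚ.∣ seq x m ℚ.- seq x n ∣ ℚ.+ ℚ.∣ seq y m ℚ.- seq y n ∣
    ≤⟨ ℚ.+-mono-≤
         (hx m n (ℕ.≤-trans (ℕ.m≤m⊔n M N) M⊔N≤m) (ℕ.≤-trans (ℕ.m≤m⊔n M N) M⊔N≤n))
         (hy m n (ℕ.≤-trans (ℕ.m≤n⊔m M N) M⊔N≤m) (ℕ.≤-trans (ℕ.m≤n⊔m M N) M⊔N≤n)) ⟩
  ½ ℚ.* ε ℚ.+ ½ ℚ.* ε
    ≡⟨ half+half ε ⟩
  ε ∎
  where open ℚ.≤-Reasoning

0ᴿ : ℝ
0ᴿ = fromℚ 0ℚ

1ᴿ : ℝ
1ᴿ = fromℚ ℚ.1ℚ

sumᴿ : ∀ {m} → Vector ℝ m → ℝ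
sumᴿ = foldr _+ᴿ_ 0ᴿ

-- `beats u v ≡ true` means that the edge u → v is present.
record Tournament (n : ℕ) : Set where
  field
    beats       : Fin n → Fin n → Bool
    irreflexive : ∀ v → beats v v ≡ false
    exactly-one : ∀ {u v} → u ≢ v → beats u v ≡ not (beats v u)

open Tournament public

module _ {n : ℕ} (T : Tournament n) where

  Edge : Fin n → Fin n → Set
  Edge u v = beats T u v ≡ true

  edge? : ∀ u v → Dec (Edge u v)
  edge? u v = beats T u v ≟ᵇ true

  -- There is a directed path of length 1 or of length 2 from v to each u ≢ v.
  -- In the second case the three vertices are automatically distinct.
  King : Pred (Fin n) 0ℓ
  King v = ∀ u → u ≢ v → Edge v u ⊎ ∃ λ w → Edge v w × Edge w u

  king? : Decidable King
  king? v = Fin.all? λ u →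
    ¬? (u Fin.≟ v) →-dec (edge? v u ⊎-dec Fin.any? λ w → edge? v w ×-dec edge? w u)

  #kings : ℕ
  #kings = length (filter king? (allFin n))

-- `nothing` plays the role of ⊥.
Output : ℕ → Set
Output n = Maybe (Subset n)

Correct : ∀ {n} → ℕ → Tournament n → Pred (Output n) 0ℓ
Correct k T (just S) = k ℕ.≤ #kings T × ∣ S ∣ ≡ k × (∀ v → v ∈ S → King T v)
Correct k T nothing  = #kings T ℕ.< k

correct? : ∀ {n} k (T : Tournament n) → Decidable (Correct k T)
correct? k T (just S) =
  k ℕ.≤? #kings T ×-dec ∣ S ∣ ℕ.≟ k ×-dec Fin.all? λ v → v ∈? S →-dec king? T v
correct? k T nothing  = #kings T ℕ.<? k

data DecisionTree (n : ℕ) : Set where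
  output : Output n → DecisionTree n
  -- Continues with the first subtree if u → v, and with the second if v → u.
  query  : (u v : Fin n) → u ≢ v → (t₁ t₂ : DecisionTree n) → DecisionTree n

run : ∀ {n} → DecisionTree n → Tournament n → Output n
run (output o)          T = o
run (query u v _ t₁ t₂) T = if beats T u v then run t₁ T else run t₂ T

#queries : ∀ {n} → DecisionTree n → Tournament n → ℕ
#queries (output _)          T = 0
#queries (query u v _ t₁ t₂) T =
  suc (if beats T u v then #queries t₁ T else #queries t₂ T)

-- The support is listed as `tree`, all weights being positive.  Finite support
-- is no restriction when the number of queries is bounded: discarding repeated
-- queries, whose answers are already known, leaves only finitely many trees.
record RandomizedAlgorithm (n : ℕ) : Set where
  field
    size       : ℕ
    tree       : Fin size → DecisionTree n
    weight     : Fin size → ℝ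
    weight-pos : ∀ i → 0ᴿ <ᴿ weight i
    weight-sum : sumᴿ weight ≃ᴿ 1ᴿ

open RandomizedAlgorithm public

Pr : ∀ {n} (A : RandomizedAlgorithm n) {P : Pred (DecisionTree n) 0ℓ} → Decidable P → ℝ
Pr A P? = sumᴿ λ i → if does (P? (tree A i)) then weight A i else 0ᴿ

FindsKings : ∀ {n} → ℕ → RandomizedAlgorithm n → Set
FindsKings {n} k A =
  (T : Tournament n) → fromℚ (+ 2 ℚ./ 3) ≤ᴿ Pr A (λ t → correct? k T (run t T))

fromℕ : ℕ → ℚ
fromℕ m = + m ℚ./ 1

-- The worst case is the maximum of `#queries` over the support and over all
-- inputs; it is at least x iff some tree on some input makes at least x queries.
WorstCaseQueries≥ : ∀ {n} → RandomizedAlgorithm n → ℚ → Set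
WorstCaseQueries≥ {n} A x =
  ∃ λ i → Σ (Tournament n) λ T → x ℚ.≤ fromℕ (#queries (tree A i) T)

-- Consider the tournament on 0, …, n − 1 in which smaller vertices beat larger ones, except that the
-- last vertex beats all vertices below some q.  Its only kings are 0, q and n − 1: the vertices x
-- between 0 and q cannot reach 0, and those between q and n − 1 cannot reach q.  Reversing the arcs
-- x₁ → y₁, …, x_k → y_k of a matching with x_a < q < y_a < n − 1 makes y₁, …, y_k kings, since y_a
-- now reaches q and all later vertices other than itself through x_a.  There are Ω(n²) disjoint such
-- matchings, and an algorithm must query an arc of each of them with probability at least 1/3.

module Submission where

open import Defs
open import Data.Nat using (ℕ; _≤_; _*_)
open import Data.Product using (∃; _×_)
open import Data.Rational as ℚ using (ℚ; 0ℚ)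

open import Algebra.Bundles using (CommutativeRing)
import Algebra.Properties.Semiring.Sum as Sum
open import Data.Bool using (true; false; if_then_else_)
import Data.Bool.Properties as Bool
open import Data.Empty using (⊥-elim)
open import Data.Fin as Fin using (Fin; zero; suc; toℕ; fromℕ<; combine; remQuot)
import Data.Fin.Properties as Fin
open import Data.Integer using (+_)
import Data.Integer as ℤ
import Data.Integer.Properties as ℤ
open import Data.List using (List; []; _∷_; length; allFin)
open import Data.List.Membership.Propositional using (_∈_)
open import Data.List.Membership.Propositional.Properties
  using (∈-filter⁺; ∈-filter⁻; ∈-tabulate⁻; ∈-allFin)
open import Data.List.Properties using (filter-notAll; length-tabulate)
open import Data.List.Relation.Binary.Subset.Propositional using (_⊆_)
import Data.List.Relation.Unary.All as All
open import Data.List.Relation.Unary.AllPairs using (_∷_)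
open import Data.List.Relation.Unary.Any as Any using (here; there)
open import Data.List.Relation.Unary.Unique.Propositional using (Unique)
import Data.List.Relation.Unary.Unique.Propositional.Properties as Unique
open import Data.Maybe using (just; nothing)
open import Data.Maybe.Properties using () renaming (≡-dec to Maybe-≡-dec)
open import Data.Nat using (zero; suc; _<_; _⊔_; _+_; _/_; _%_; NonZero; >-nonZero; >-nonZero⁻¹; z≤n; s≤s; s<s⁻¹)
open import Data.Nat.DivMod using (m≡m%n+[m/n]*n; m%n<n; m/n*n≤m; m≥n⇒m/n>0)
import Data.Nat.Properties as ℕ
open import Data.Nat.Solver renaming (module +-*-Solver to ℕ-Solver)
open import Data.Product using (_,_; proj₁; proj₂)
open import Data.Rational using (1ℚ)
import Data.Rational.Properties as ℚ
open import Data.Rational.Solver using (module +-*-Solver)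
open import Data.Rational.Unnormalised as ℚᵘ using (mkℚᵘ; *≡*; *≤*)
import Data.Rational.Unnormalised.Properties as ℚᵘ
open import Data.Sum using (_⊎_; inj₁; inj₂; [_,_])
import Data.Vec.Properties as Vec
open import Data.Vec.Functional using (Vector)
open import Function using (_∘_; case_of_; mk⇔)
open import Level using (0ℓ)
open import Relation.Binary.Definitions using (DecidableEquality; tri<; tri≈; tri>)
open import Relation.Binary.PropositionalEquality hiding ([_])
open import Relation.Nullary using (Dec; yes; no; does; ¬_; ¬?; _×-dec_; _⊎-dec_; contradiction)
open import Relation.Nullary.Decidable using (from-yes; decidable-stable; dec-true; dec-false; does-⇔)
open import Relation.Unary using (Pred; Decidable)

open Sum (CommutativeRing.semiring ℚ.+-*-commutativeRing)
  using (sum; sum-cong-≗; ∑-distrib-+; ∑-comm; *-distribˡ-sum; *-distribʳ-sum)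

private variable m n : ℕ

-- Natural numbers inside the rationals.

fromℕ-* : ∀ a b → fromℕ (a * b) ≡ fromℕ a ℚ.* fromℕ b
fromℕ-* a b = ℚ.toℚᵘ-injective (begin
  ℚ.toℚᵘ (fromℕ (a * b))                    ≈⟨ ℚ.toℚᵘ-fromℚᵘ _ ⟩
  mkℚᵘ (+ (a * b)) 0                        ≈⟨ *≡* (cong (ℤ._* + 1) (ℤ.pos-* a b)) ⟩
  mkℚᵘ (+ a) 0 ℚᵘ.* mkℚᵘ (+ b) 0            ≈⟨ ℚᵘ.*-cong (ℚ.toℚᵘ-fromℚᵘ (mkℚᵘ (+ a) 0)) (ℚ.toℚᵘ-fromℚᵘ (mkℚᵘ (+ b) 0)) ⟨
  ℚ.toℚᵘ (fromℕ a) ℚᵘ.* ℚ.toℚᵘ (fromℕ b)    ≈⟨ ℚ.toℚᵘ-homo-* (fromℕ a) (fromℕ b) ⟨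
  ℚ.toℚᵘ (fromℕ a ℚ.* fromℕ b)              ∎)
  where open ℚᵘ.≃-Reasoning

fromℕ-suc : ∀ a → fromℕ (suc a) ≡ 1ℚ ℚ.+ fromℕ a
fromℕ-suc a = ℚ.toℚᵘ-injective (begin
  ℚ.toℚᵘ (fromℕ (suc a))                    ≈⟨ ℚ.toℚᵘ-fromℚᵘ _ ⟩
  mkℚᵘ (+ suc a) 0                          ≈⟨ *≡* (cong (λ x → (+ 1 ℤ.+ x) ℤ.* + 1) (sym (ℤ.*-identityʳ (+ a)))) ⟩
  mkℚᵘ (+ 1) 0 ℚᵘ.+ mkℚᵘ (+ a) 0            ≈⟨ ℚᵘ.+-congʳ (mkℚᵘ (+ 1) 0) (ℚ.toℚᵘ-fromℚᵘ (mkℚᵘ (+ a) 0)) ⟨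
  ℚ.toℚᵘ 1ℚ ℚᵘ.+ ℚ.toℚᵘ (fromℕ a)           ≈⟨ ℚ.toℚᵘ-homo-+ 1ℚ (fromℕ a) ⟨
  ℚ.toℚᵘ (1ℚ ℚ.+ fromℕ a)                   ∎)
  where open ℚᵘ.≃-Reasoning

fromℕ-mono-≤ : ∀ {a b} → a ≤ b → fromℕ a ℚ.≤ fromℕ b
fromℕ-mono-≤ {a} {b} a≤b = ℚ.toℚᵘ-cancel-≤ (begin
  ℚ.toℚᵘ (fromℕ a)  ≃⟨ ℚ.toℚᵘ-fromℚᵘ _ ⟩
  mkℚᵘ (+ a) 0      ≤⟨ *≤* (ℤ.*-monoʳ-≤-nonNeg (+ 1) (ℤ.+≤+ a≤b)) ⟩
  mkℚᵘ (+ b) 0      ≃⟨ ℚ.toℚᵘ-fromℚᵘ _ ⟨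
  ℚ.toℚᵘ (fromℕ b)  ∎)
  where open ℚᵘ.≤-Reasoning

fromℕ-nonNeg : ∀ a → 0ℚ ℚ.≤ fromℕ a
fromℕ-nonNeg a = fromℕ-mono-≤ (z≤n {a})

1/d*fromℕ[d*a] : ∀ d .{{_ : NonZero d}} a → (+ 1 ℚ./ d) ℚ.* fromℕ (d * a) ≡ fromℕ a
1/d*fromℕ[d*a] d@(suc d-1) a = begin
  (+ 1 ℚ./ d) ℚ.* fromℕ (d * a)                 ≡⟨ cong ((+ 1 ℚ./ d) ℚ.*_) (fromℕ-* d a) ⟩
  (+ 1 ℚ./ d) ℚ.* (fromℕ d ℚ.* fromℕ a)         ≡⟨ ℚ.*-assoc (+ 1 ℚ./ d) (fromℕ d) (fromℕ a) ⟨
  ((+ 1 ℚ./ d) ℚ.* fromℕ d) ℚ.* fromℕ a         ≡⟨ cong (ℚ._* fromℕ a) inverse ⟩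
  1ℚ ℚ.* fromℕ a                                ≡⟨ ℚ.*-identityˡ (fromℕ a) ⟩
  fromℕ a                                       ∎
  where
  open ≡-Reasoning
  inverse : (+ 1 ℚ./ d) ℚ.* fromℕ d ≡ 1ℚ
  inverse = ℚ.toℚᵘ-injective (ℚᵘ.≃-trans (ℚ.toℚᵘ-homo-* (+ 1 ℚ./ d) (fromℕ d))
    (ℚᵘ.≃-trans (ℚᵘ.*-cong (ℚ.toℚᵘ-fromℚᵘ (mkℚᵘ (+ 1) d-1)) (ℚ.toℚᵘ-fromℚᵘ (mkℚᵘ (+ d) 0)))
      (*≡* (trans (ℤ.*-identityʳ (+ 1 ℤ.* + d)) (cong (λ x → + 1 ℤ.* (+ x)) (sym (ℕ.*-identityʳ d)))))))

+-cancelˡ-≤ : ∀ r {p q} → r ℚ.+ p ℚ.≤ r ℚ.+ q → p ℚ.≤ q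
+-cancelˡ-≤ r r+p≤r+q = ℚ.≮⇒≥ λ q<p → ℚ.<-irrefl refl (ℚ.<-≤-trans (ℚ.+-monoʳ-< r q<p) r+p≤r+q)

-- Finite rational sums and indicators.

sum-mono-≤ : {f g : Vector ℚ n} → (∀ i → f i ℚ.≤ g i) → sum f ℚ.≤ sum g
sum-mono-≤ {n = zero}  f≤g = ℚ.≤-refl
sum-mono-≤ {n = suc n} f≤g = ℚ.+-mono-≤ (f≤g zero) (sum-mono-≤ (f≤g ∘ suc))

sum-const : ∀ n q → sum {n} (λ _ → q) ≡ fromℕ n ℚ.* q
sum-const zero    q = sym (ℚ.*-zeroˡ q)
sum-const (suc n) q = begin
  q ℚ.+ sum {n} (λ _ → q)           ≡⟨ cong₂ ℚ._+_ (sym (ℚ.*-identityˡ q)) (sum-const n q) ⟩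
  1ℚ ℚ.* q ℚ.+ fromℕ n ℚ.* q        ≡⟨ ℚ.*-distribʳ-+ q 1ℚ (fromℕ n) ⟨
  (1ℚ ℚ.+ fromℕ n) ℚ.* q            ≡⟨ cong (ℚ._* q) (fromℕ-suc n) ⟨
  fromℕ (suc n) ℚ.* q               ∎
  where open ≡-Reasoning

𝟙 : {P : Set} → Dec P → ℚ
𝟙 P? = if does P? then 1ℚ else 0ℚ

sum-𝟙-none : {P : Pred (Fin n) 0ℓ} (P? : Decidable P) → (∀ i → ¬ P i) → sum (𝟙 ∘ P?) ≡ 0ℚ
sum-𝟙-none {n = zero}  P? ¬P = refl
sum-𝟙-none {n = suc n} P? ¬P with P? zero
... | yes p = contradiction p (¬P zero)
... | no _  = trans (ℚ.+-identityˡ _) (sum-𝟙-none (P? ∘ suc) (¬P ∘ suc))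

sum-𝟙-unique : {P : Pred (Fin n) 0ℓ} (P? : Decidable P) →
               (∀ {i j} → P i → P j → i ≡ j) → sum (𝟙 ∘ P?) ℚ.≤ 1ℚ
sum-𝟙-unique {n = zero}  P? unique = from-yes (0ℚ ℚ.≤? 1ℚ)
sum-𝟙-unique {n = suc n} P? unique with P? zero
... | yes p = ℚ.≤-reflexive (cong (1ℚ ℚ.+_)
                (sum-𝟙-none (P? ∘ suc) λ i q → Fin.0≢1+n (unique p q)))
... | no _  = subst (ℚ._≤ 1ℚ) (sym (ℚ.+-identityˡ _))
                (sum-𝟙-unique (P? ∘ suc) λ p q → Fin.suc-injective (unique p q))

-- The hypothesis places P inside the union of Q and R, so this is the union bound before summation.
𝟙-⊎ : {P Q R : Set} (P? : Dec P) (Q? : Dec Q) (R? : Dec R) →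
      (P → ¬ Q → R) → 𝟙 P? ℚ.≤ 𝟙 Q? ℚ.+ 𝟙 R?
𝟙-⊎ (no _)  (no _)  (no _)  _ = from-yes (0ℚ ℚ.≤? 0ℚ)
𝟙-⊎ (no _)  (no _)  (yes _) _ = from-yes (0ℚ ℚ.≤? 1ℚ)
𝟙-⊎ (no _)  (yes _) (no _)  _ = from-yes (0ℚ ℚ.≤? 1ℚ)
𝟙-⊎ (no _)  (yes _) (yes _) _ = from-yes (0ℚ ℚ.≤? (1ℚ ℚ.+ 1ℚ))
𝟙-⊎ (yes _) (yes _) (no _)  _ = from-yes (1ℚ ℚ.≤? 1ℚ)
𝟙-⊎ (yes _) (yes _) (yes _) _ = from-yes (1ℚ ℚ.≤? (1ℚ ℚ.+ 1ℚ))
𝟙-⊎ (yes _) (no _)  (yes _) _ = from-yes (1ℚ ℚ.≤? 1ℚ)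
𝟙-⊎ (yes p) (no ¬q) (no ¬r) f = contradiction (f p ¬q) ¬r

-- Inclusion-exclusion before averaging: P and Q can hold together only where R holds. After
-- weighting, two success probabilities above one half yield a lower bound on the probability of R.
𝟙-× : {P Q R : Set} (P? : Dec P) (Q? : Dec Q) (R? : Dec R) →
      (P → Q → R) → 𝟙 P? ℚ.+ 𝟙 Q? ℚ.≤ 1ℚ ℚ.+ 𝟙 R?
𝟙-× (no _)  (no _)  (no _)  _ = from-yes (0ℚ ℚ.≤? 1ℚ)
𝟙-× (no _)  (no _)  (yes _) _ = from-yes (0ℚ ℚ.≤? (1ℚ ℚ.+ 1ℚ))
𝟙-× (no _)  (yes _) (no _)  _ = from-yes (1ℚ ℚ.≤? 1ℚ)
𝟙-× (no _)  (yes _) (yes _) _ = from-yes (1ℚ ℚ.≤? (1ℚ ℚ.+ 1ℚ))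
𝟙-× (yes _) (no _)  (no _)  _ = from-yes (1ℚ ℚ.≤? 1ℚ)
𝟙-× (yes _) (no _)  (yes _) _ = from-yes (1ℚ ℚ.≤? (1ℚ ℚ.+ 1ℚ))
𝟙-× (yes _) (yes _) (yes _) _ = ℚ.≤-refl
𝟙-× (yes p) (yes q) (no ¬r) f = contradiction (f p q) ¬r

-- Properties of sequences that hold from some index on.

eventually-∀ : {P : Fin m → Pred ℕ 0ℓ} → (∀ i → Eventually (P i)) →
               Eventually (λ n → ∀ i → P i n)
eventually-∀ {m = zero}  h = 0 , λ _ _ ()
eventually-∀ {m = suc m} h with h zero | eventually-∀ (h ∘ suc)
... | M , hM | N , hN = M ⊔ N , λ where
  n M⊔N≤n zero    → hM n (ℕ.m⊔n≤o⇒m≤o M N M⊔N≤n)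
  n M⊔N≤n (suc i) → hN n (ℕ.m⊔n≤o⇒n≤o M N M⊔N≤n) i

eventually-× : {P Q : Pred ℕ 0ℓ} → Eventually P → Eventually Q → Eventually (λ n → P n × Q n)
eventually-× (M , hM) (N , hN) = M ⊔ N , λ n M⊔N≤n →
  hM n (ℕ.m⊔n≤o⇒m≤o M N M⊔N≤n) , hN n (ℕ.m⊔n≤o⇒n≤o M N M⊔N≤n)

seq-sumᴿ : (x : Vector ℝ m) (N : ℕ) → seq (sumᴿ x) N ≡ sum (λ i → seq (x i) N)
seq-sumᴿ {m = zero}  x N = refl
seq-sumᴿ {m = suc m} x N = cong (seq (x zero) N ℚ.+_) (seq-sumᴿ (x ∘ suc) N)

-- How many tournaments a deterministic decision tree can tell from a given one.

_≟ᵒ_ : DecidableEquality (Output n)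
_≟ᵒ_ = Maybe-≡-dec (Vec.≡-dec Bool._≟_)

module _ {n M : ℕ} (T : Tournament n) (T′ : Fin M → Tournament n)
  (disjoint : ∀ u v {b b′} → beats (T′ b) u v ≢ beats T u v →
              beats (T′ b′) u v ≢ beats T u v → b ≡ b′) where

  runs-differ? : (t : DecisionTree n) → Decidable (λ b → run t (T′ b) ≢ run t T)
  runs-differ? t b = ¬? (run t (T′ b) ≟ᵒ run t T)

  private
    -- Here `t′` is the subtree of `t` that the answer of `T` leads to. If `T′ b` gets a different
    -- output from `t`, then either it answers the query differently, which by `disjoint` happens
    -- for at most one `b`, or it also enters `t′` and differs there. So the query adds at most one
    -- to the count.
    add-query : ∀ u v (t t′ : DecisionTree n) →
      (∀ T″ → beats T″ u v ≡ beats T u v → run t T″ ≡ run t′ T″) →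
      #queries t T ≡ suc (#queries t′ T) →
      sum (𝟙 ∘ runs-differ? t′) ℚ.≤ fromℕ (#queries t′ T) →
      sum (𝟙 ∘ runs-differ? t) ℚ.≤ fromℕ (#queries t T)
    add-query u v t t′ run≡ #queries≡ IH = begin
      sum (𝟙 ∘ runs-differ? t)
        ≤⟨ sum-mono-≤ (λ b → 𝟙-⊎ (runs-differ? t b) (flipped? b) (runs-differ? t′ b) (differ b)) ⟩
      sum (λ b → 𝟙 (flipped? b) ℚ.+ 𝟙 (runs-differ? t′ b))
        ≡⟨ ∑-distrib-+ (𝟙 ∘ flipped?) (𝟙 ∘ runs-differ? t′) ⟩
      sum (𝟙 ∘ flipped?) ℚ.+ sum (𝟙 ∘ runs-differ? t′)
        ≤⟨ ℚ.+-mono-≤ (sum-𝟙-unique flipped? (disjoint u v)) IH ⟩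
      1ℚ ℚ.+ fromℕ (#queries t′ T)
        ≡⟨ fromℕ-suc (#queries t′ T) ⟨
      fromℕ (suc (#queries t′ T))
        ≡⟨ cong fromℕ #queries≡ ⟨
      fromℕ (#queries t T) ∎
      where
      open ℚ.≤-Reasoning
      flipped? : Decidable (λ b → beats (T′ b) u v ≢ beats T u v)
      flipped? b = ¬? (beats (T′ b) u v Bool.≟ beats T u v)

      differ : ∀ b → run t (T′ b) ≢ run t T → ¬ (beats (T′ b) u v ≢ beats T u v) →
               run t′ (T′ b) ≢ run t′ T
      differ b t≢ ¬flipped t′≡ =
        t≢ (trans (run≡ (T′ b) (decidable-stable (_ Bool.≟ _) ¬flipped)) (trans t′≡ (sym (run≡ T refl))))

  -- Induction along the path that `T` takes: a tournament can get another output only by leaving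
  -- this path, and each query on it makes at most one `T′ b` leave.
  differing≤#queries : ∀ t → sum (𝟙 ∘ runs-differ? t) ℚ.≤ fromℕ (#queries t T)
  differing≤#queries (output o) =
    ℚ.≤-reflexive (sum-𝟙-none (runs-differ? (output o)) λ _ o≢o → o≢o refl)
  differing≤#queries t@(query u v _ t₁ t₂) = branch (beats T u v) refl
    where
    branch : ∀ answer → beats T u v ≡ answer →
             sum (𝟙 ∘ runs-differ? t) ℚ.≤ fromℕ (#queries t T)
    branch true  T≡ = add-query u v t t₁
      (λ T″ same → cong (if_then run t₁ T″ else run t₂ T″) (trans same T≡))
      (cong (λ c → suc (if c then #queries t₁ T else #queries t₂ T)) T≡)
      (differing≤#queries t₁)
    branch false T≡ = add-query u v t t₂
      (λ T″ same → cong (if_then run t₁ T″ else run t₂ T″) (trans same T≡))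
      (cong (λ c → suc (if c then #queries t₁ T else #queries t₂ T)) T≡)
      (differing≤#queries t₂)

-- Real weights and probabilities at a single index of their Cauchy sequences.

nonNeg : ∀ {x} → 0ᴿ <ᴿ x → Eventually (λ N → 0ℚ ℚ.≤ seq x N)
nonNeg (ε , 0<ε , M , h) = M , λ N M≤N →
  ℚ.≤-trans (subst (0ℚ ℚ.≤_) (sym (ℚ.+-identityˡ ε)) (ℚ.<⇒≤ 0<ε)) (h N M≤N)

≃ᴿ-fromℚ⇒≤ : ∀ {x q ε} → 0ℚ ℚ.< ε → x ≃ᴿ fromℚ q → Eventually (λ N → seq x N ℚ.≤ q ℚ.+ ε)
≃ᴿ-fromℚ⇒≤ {x} {q} {ε} 0<ε x≃q with x≃q ε 0<ε
... | M , h = M , λ N M≤N → begin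
  seq x N                          ≡⟨ solve 2 (λ a b → a := b :+ (a :- b)) refl (seq x N) q ⟩
  q ℚ.+ (seq x N ℚ.- q)            ≤⟨ ℚ.+-monoʳ-≤ q (p≤∣p∣ (seq x N ℚ.- q)) ⟩
  q ℚ.+ ℚ.∣ seq x N ℚ.- q ∣        ≤⟨ ℚ.+-monoʳ-≤ q (h N M≤N) ⟩
  q ℚ.+ ε                          ∎
  where
  open ℚ.≤-Reasoning
  open +-*-Solver
  p≤∣p∣ : ∀ p → p ℚ.≤ ℚ.∣ p ∣
  p≤∣p∣ p with ℚ.≤-total 0ℚ p
  ... | inj₁ 0≤p = ℚ.≤-reflexive (sym (ℚ.0≤p⇒∣p∣≡p 0≤p))
  ... | inj₂ p≤0 = ℚ.≤-trans p≤0 (ℚ.nonNegative⁻¹ ℚ.∣ p ∣ {{ℚ.∣-∣-nonNeg p}})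

seq-Pr : ∀ (A : RandomizedAlgorithm n) {P : Pred (DecisionTree n) 0ℓ} (P? : Decidable P) N →
         seq (Pr A P?) N ≡ sum (λ i → seq (weight A i) N ℚ.* 𝟙 (P? (tree A i)))
seq-Pr A P? N = trans (seq-sumᴿ (λ i → if does (P? (tree A i)) then weight A i else 0ᴿ) N)
                      (sum-cong-≗ λ i → if-*-𝟙 i (does (P? (tree A i))))
  where
  if-*-𝟙 : ∀ i c → seq (if c then weight A i else 0ᴿ) N ≡
                   seq (weight A i) N ℚ.* (if c then 1ℚ else 0ℚ)
  if-*-𝟙 i true  = sym (ℚ.*-identityʳ _)
  if-*-𝟙 i false = sym (ℚ.*-zeroʳ (seq (weight A i) N))

-- Averaging over the trees of a randomized algorithm.

module _ {n M k : ℕ} (T : Tournament n) (T′ : Fin M → Tournament n)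
  (disjoint : ∀ u v {b b′} → beats (T′ b) u v ≢ beats T u v →
              beats (T′ b′) u v ≢ beats T u v → b ≡ b′)
  (incompatible : ∀ b {o} → Correct k T o → ¬ Correct k (T′ b) o)
  (A : RandomizedAlgorithm n) (finds : FindsKings k A) where

  -- The weights are replaced by rational approximations s, taken at an index N from which on
  -- all the finitely many inequalities assumed about the weights hold up to ε.
  private
    ε ¼ ⅛ : ℚ
    -- Three errors of size `ε` occur below, one for each of two success probabilities and one for
    -- the total weight. Out of 2/3 + 2/3 - 1 = 1/3 they leave 1/3 - 3/36 = `¼`.
    ε = + 1 ℚ./ 36
    ¼ = + 1 ℚ./ 4
    ⅛ = + 1 ℚ./ 8

    0<ε : 0ℚ ℚ.< ε
    0<ε = from-yes (0ℚ ℚ.<? ε)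

    success : Tournament n → ℝ
    success S = Pr A λ t → correct? k S (run t S)

    Typical : Pred ℕ 0ℓ
    Typical N = (∀ i → 0ℚ ℚ.≤ seq (weight A i) N) ×
                seq (sumᴿ (weight A)) N ℚ.≤ 1ℚ ℚ.+ ε ×
                (+ 2 ℚ./ 3) ℚ.≤ seq (success T) N ℚ.+ ε ×
                (∀ b → (+ 2 ℚ./ 3) ℚ.≤ seq (success (T′ b)) N ℚ.+ ε)

    typical : Eventually Typical
    typical = eventually-× (eventually-∀ λ i → nonNeg {weight A i} (weight-pos A i))
             (eventually-× (≃ᴿ-fromℚ⇒≤ {sumᴿ (weight A)} {1ℚ} 0<ε (weight-sum A))
             (eventually-× (finds T ε 0<ε)
                           (eventually-∀ λ b → finds (T′ b) ε 0<ε)))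

    N : ℕ
    N = proj₁ typical

    s : Vector ℚ (size A)
    s i = seq (weight A i) N

    s-nonNeg : ∀ i → 0ℚ ℚ.≤ s i
    s-nonNeg = proj₁ (proj₂ typical N ℕ.≤-refl)

    ∑s≤ : sum s ℚ.≤ 1ℚ ℚ.+ ε
    ∑s≤ = subst (ℚ._≤ 1ℚ ℚ.+ ε) (seq-sumᴿ (weight A) N)
                (proj₁ (proj₂ (proj₂ typical N ℕ.≤-refl)))

    correctᵢ? : ∀ S i → Dec (Correct k S (run (tree A i) S))
    correctᵢ? S i = correct? k S (run (tree A i) S)

    success≥ : ∀ S → (+ 2 ℚ./ 3) ℚ.≤ seq (success S) N ℚ.+ ε →
               (+ 2 ℚ./ 3) ℚ.≤ sum (λ i → s i ℚ.* 𝟙 (correctᵢ? S i)) ℚ.+ ε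
    success≥ S = subst (λ p → (+ 2 ℚ./ 3) ℚ.≤ p ℚ.+ ε) (seq-Pr A (λ t → correct? k S (run t S)) N)

    differ? : ∀ b i → Dec (run (tree A i) (T′ b) ≢ run (tree A i) T)
    differ? b i = runs-differ? T T′ disjoint (tree A i) b

    -- A tree that is correct on both T and T′ b must tell them apart.
    detection-probability : ∀ b → ¼ ℚ.≤ sum (λ i → s i ℚ.* 𝟙 (differ? b i))
    detection-probability b = +-cancelˡ-≤ (1ℚ ℚ.+ ε ℚ.+ (ε ℚ.+ ε)) (begin
      -- This evaluates to 4/3, as does the sum of the cancelled term 1 + 3ε and `¼`.
      + 2 ℚ./ 3 ℚ.+ + 2 ℚ./ 3
        ≤⟨ ℚ.+-mono-≤ (success≥ T (proj₁ (proj₂ (proj₂ (proj₂ typical N ℕ.≤-refl)))))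
                      (success≥ (T′ b) (proj₂ (proj₂ (proj₂ (proj₂ typical N ℕ.≤-refl))) b)) ⟩
      (∑C ℚ.+ ε) ℚ.+ (∑C′ ℚ.+ ε)
        ≡⟨ solve 3 (λ c c′ e → (c :+ e) :+ (c′ :+ e) := (c :+ c′) :+ (e :+ e)) refl ∑C ∑C′ ε ⟩
      (∑C ℚ.+ ∑C′) ℚ.+ (ε ℚ.+ ε)
        ≤⟨ ℚ.+-monoˡ-≤ (ε ℚ.+ ε) ∑C+∑C′≤ ⟩
      (sum s ℚ.+ ∑D) ℚ.+ (ε ℚ.+ ε)
        ≤⟨ ℚ.+-monoˡ-≤ (ε ℚ.+ ε) (ℚ.+-monoˡ-≤ ∑D ∑s≤) ⟩
      ((1ℚ ℚ.+ ε) ℚ.+ ∑D) ℚ.+ (ε ℚ.+ ε)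
        ≡⟨ solve 3 (λ a d e → (a :+ d) :+ e := (a :+ e) :+ d) refl (1ℚ ℚ.+ ε) ∑D (ε ℚ.+ ε) ⟩
      (1ℚ ℚ.+ ε ℚ.+ (ε ℚ.+ ε)) ℚ.+ ∑D ∎)
      where
      open ℚ.≤-Reasoning
      open +-*-Solver
      ∑C ∑C′ ∑D : ℚ
      ∑C  = sum (λ i → s i ℚ.* 𝟙 (correctᵢ? T i))
      ∑C′ = sum (λ i → s i ℚ.* 𝟙 (correctᵢ? (T′ b) i))
      ∑D  = sum (λ i → s i ℚ.* 𝟙 (differ? b i))

      tells-apart : ∀ i → Correct k T (run (tree A i) T) →
                    Correct k (T′ b) (run (tree A i) (T′ b)) → run (tree A i) (T′ b) ≢ run (tree A i) T
      tells-apart i c c′ run≡ = incompatible b c (subst (Correct k (T′ b)) run≡ c′)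

      ∑C+∑C′≤ : ∑C ℚ.+ ∑C′ ℚ.≤ sum s ℚ.+ ∑D
      ∑C+∑C′≤ = begin
        ∑C ℚ.+ ∑C′
          ≡⟨ ∑-distrib-+ (λ i → s i ℚ.* 𝟙 (correctᵢ? T i)) (λ i → s i ℚ.* 𝟙 (correctᵢ? (T′ b) i)) ⟨
        sum (λ i → s i ℚ.* 𝟙 (correctᵢ? T i) ℚ.+ s i ℚ.* 𝟙 (correctᵢ? (T′ b) i))
          ≤⟨ sum-mono-≤ (λ i → begin
               s i ℚ.* 𝟙 (correctᵢ? T i) ℚ.+ s i ℚ.* 𝟙 (correctᵢ? (T′ b) i)
                 ≡⟨ ℚ.*-distribˡ-+ (s i) _ _ ⟨
               s i ℚ.* (𝟙 (correctᵢ? T i) ℚ.+ 𝟙 (correctᵢ? (T′ b) i))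
                 ≤⟨ ℚ.*-monoˡ-≤-nonNeg (s i) {{ℚ.nonNegative (s-nonNeg i)}}
                      (𝟙-× (correctᵢ? T i) (correctᵢ? (T′ b) i) (differ? b i) (tells-apart i)) ⟩
               s i ℚ.* (1ℚ ℚ.+ 𝟙 (differ? b i))
                 ≡⟨ trans (ℚ.*-distribˡ-+ (s i) 1ℚ (𝟙 (differ? b i))) (cong (ℚ._+ s i ℚ.* 𝟙 (differ? b i)) (ℚ.*-identityʳ (s i))) ⟩
               s i ℚ.+ s i ℚ.* 𝟙 (differ? b i) ∎) ⟩
        sum (λ i → s i ℚ.+ s i ℚ.* 𝟙 (differ? b i))
          ≡⟨ ∑-distrib-+ s (λ i → s i ℚ.* 𝟙 (differ? b i)) ⟩
        sum s ℚ.+ ∑D ∎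

    -- Double counting of the pairs (b, i) such that tree i tells `T′ b` from `T`. Weighted by `s`,
    -- every b collects at least `¼`, while tree i occurs with at most as many b as it makes queries
    -- on `T`.
    expected-#queries : fromℕ M ℚ.* ¼ ℚ.≤ sum (λ i → s i ℚ.* fromℕ (#queries (tree A i) T))
    expected-#queries = begin
      fromℕ M ℚ.* ¼
        ≡⟨ sum-const M ¼ ⟨
      sum {M} (λ _ → ¼)
        ≤⟨ sum-mono-≤ detection-probability ⟩
      sum (λ b → sum (λ i → s i ℚ.* 𝟙 (differ? b i)))
        ≡⟨ ∑-comm (λ b i → s i ℚ.* 𝟙 (differ? b i)) ⟩
      sum (λ i → sum (λ b → s i ℚ.* 𝟙 (differ? b i)))
        ≡⟨ sum-cong-≗ (λ i → *-distribˡ-sum (s i) (λ b → 𝟙 (differ? b i))) ⟨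
      sum (λ i → s i ℚ.* sum (λ b → 𝟙 (differ? b i)))
        ≤⟨ sum-mono-≤ (λ i → ℚ.*-monoˡ-≤-nonNeg (s i) {{ℚ.nonNegative (s-nonNeg i)}}
             (differing≤#queries T T′ disjoint (tree A i))) ⟩
      sum (λ i → s i ℚ.* fromℕ (#queries (tree A i) T)) ∎
      where open ℚ.≤-Reasoning

  -- If every tree made at most M/8 queries on `T`, the weighted number of queries would be at most
  -- (1 + ε)M/8, which for positive M is less than the lower bound M/4. The search for the tree is
  -- decidable because the support is finite.
  many-queries : 0 < M → ∃ λ i → M < 8 * #queries (tree A i) T
  many-queries 0<M with Fin.any? (λ i → M ℕ.<? 8 * #queries (tree A i) T)
  ... | yes found = found
  ... | no none   = ⊥-elim (ℚ.<-irrefl refl (begin-strict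
    fromℕ M ℚ.* ¼
      ≤⟨ expected-#queries ⟩
    sum (λ i → s i ℚ.* fromℕ (#queries (tree A i) T))
      ≤⟨ sum-mono-≤ (λ i → ℚ.*-monoˡ-≤-nonNeg (s i) {{ℚ.nonNegative (s-nonNeg i)}} (few i)) ⟩
    sum (λ i → s i ℚ.* (⅛ ℚ.* fromℕ M))
      ≡⟨ *-distribʳ-sum (⅛ ℚ.* fromℕ M) s ⟨
    sum s ℚ.* (⅛ ℚ.* fromℕ M)
      ≡⟨ ℚ.*-assoc (sum s) ⅛ (fromℕ M) ⟨
    (sum s ℚ.* ⅛) ℚ.* fromℕ M
      ≤⟨ ℚ.*-monoʳ-≤-nonNeg (fromℕ M) {{ℚ.nonNegative (fromℕ-nonNeg M)}} (ℚ.*-monoʳ-≤-nonNeg ⅛ ∑s≤) ⟩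
    ((1ℚ ℚ.+ ε) ℚ.* ⅛) ℚ.* fromℕ M
      <⟨ ℚ.*-monoˡ-<-pos (fromℕ M) {{ℚ.positive 0<fromℕM}} (from-yes (((1ℚ ℚ.+ ε) ℚ.* ⅛) ℚ.<? ¼)) ⟩
    ¼ ℚ.* fromℕ M
      ≡⟨ ℚ.*-comm ¼ (fromℕ M) ⟩
    fromℕ M ℚ.* ¼ ∎))
    where
    open ℚ.≤-Reasoning

    0<fromℕM : 0ℚ ℚ.< fromℕ M
    0<fromℕM = ℚ.<-≤-trans (from-yes (0ℚ ℚ.<? fromℕ 1)) (fromℕ-mono-≤ 0<M)

    few : ∀ i → fromℕ (#queries (tree A i) T) ℚ.≤ ⅛ ℚ.* fromℕ M
    few i = begin
      fromℕ (#queries (tree A i) T)               ≡⟨ 1/d*fromℕ[d*a] 8 (#queries (tree A i) T) ⟨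
      ⅛ ℚ.* fromℕ (8 * #queries (tree A i) T)     ≤⟨ ℚ.*-monoˡ-≤-nonNeg ⅛ (fromℕ-mono-≤ (ℕ.≮⇒≥ (λ lt → none (i , lt)))) ⟩
      ⅛ ℚ.* fromℕ M                               ∎

-- Tournaments obtained from a linear order by reversing arcs.

does-true : {P : Set} (P? : Dec P) → does P? ≡ true → P
does-true (yes p) refl = p

-- R tells which of the arcs from smaller to larger vertices are reversed; only its values R x y with
-- x < y matter.
module Orientation {n : ℕ} {R : Fin n → Fin n → Set} (R? : ∀ x y → Dec (R x y)) where

  Arc : Fin n → Fin n → Set
  Arc x y = (x Fin.< y × ¬ R x y) ⊎ (y Fin.< x × R y x)

  arc? : ∀ x y → Dec (Arc x y)
  arc? x y = (x Fin.<? y ×-dec ¬? (R? x y)) ⊎-dec (y Fin.<? x ×-dec R? y x)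

  private
    asym : ∀ {x y} → Arc x y → ¬ Arc y x
    asym (inj₁ (x<y , ¬r)) (inj₁ (y<x , _)) = Fin.<-asym x<y y<x
    asym (inj₁ (x<y , ¬r)) (inj₂ (_ , r))   = ¬r r
    asym (inj₂ (y<x , r))  (inj₁ (_ , ¬r))  = ¬r r
    asym (inj₂ (y<x , r))  (inj₂ (x<y , _)) = Fin.<-asym x<y y<x

    total : ∀ {x y} → x ≢ y → ¬ Arc y x → Arc x y
    total {x} {y} x≢y ¬yx with Fin.<-cmp x y
    ... | tri< x<y _ _ = inj₁ (x<y , λ r → ¬yx (inj₂ (x<y , r)))
    ... | tri≈ _ x≡y _ = contradiction x≡y x≢y
    ... | tri> _ _ y<x = inj₂ (y<x , decidable-stable (R? y x) λ ¬r → ¬yx (inj₁ (y<x , ¬r)))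

  orient : Tournament n
  orient .beats x y = does (arc? x y)
  orient .irreflexive x = dec-false (arc? x x) λ x→x → asym x→x x→x
  orient .exactly-one {x} {y} x≢y =
    does-⇔ (mk⇔ asym (total x≢y)) (arc? x y) (¬? (arc? y x))

  arc⇒edge : ∀ {x y} → Arc x y → Edge orient x y
  arc⇒edge {x} {y} = dec-true (arc? x y)

  edge⇒arc : ∀ {x y} → Edge orient x y → Arc x y
  edge⇒arc {x} {y} = does-true (arc? x y)

-- Counting kings.

-- Filtering the head of `xs` out of `ys` keeps all other elements of `xs`, which differ from the
-- head, and makes `ys` strictly shorter.
unique-⊆⇒length≤ : {xs ys : List (Fin n)} → Unique xs → xs ⊆ ys → length xs ≤ length ys
unique-⊆⇒length≤ {xs = []} _ _ = z≤n
unique-⊆⇒length≤ {xs = x ∷ xs} {ys} (x∉xs ∷ xs!) xs⊆ys = ℕ.≤-<-trans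
  (unique-⊆⇒length≤ xs! λ y∈xs →
    ∈-filter⁺ (λ y → ¬? (x Fin.≟ y)) (xs⊆ys (there y∈xs)) (All.lookup x∉xs y∈xs))
  (filter-notAll (λ y → ¬? (x Fin.≟ y)) ys (Any.map (λ x≡y x≢y → x≢y x≡y) (xs⊆ys (here refl))))

module _ (T : Tournament n) where

  kings⊆⇒#kings≤ : ∀ {xs} → (∀ v → King T v → v ∈ xs) → #kings T ≤ length xs
  kings⊆⇒#kings≤ kings⊆xs = unique-⊆⇒length≤ (Unique.filter⁺ (king? T) (Unique.allFin⁺ n))
    λ {v} v∈ → kings⊆xs v (proj₂ (∈-filter⁻ (king? T) {xs = allFin n} v∈))

  injective-kings⇒≤#kings : {f : Fin m → Fin n} → (∀ {a b} → f a ≡ f b → a ≡ b) →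
                            (∀ a → King T (f a)) → m ≤ #kings T
  injective-kings⇒≤#kings {m} {f} f-inj kings = subst (_≤ #kings T) (length-tabulate f)
    (unique-⊆⇒length≤ (Unique.tabulate⁺ f-inj) λ v∈ → case ∈-tabulate⁻ v∈ of λ where
      (a , refl) → ∈-filter⁺ (king? T) (∈-allFin (f a)) (kings a))

-- The base tournament and its modifications.

-- There are m * m matchings, indexed by (i , j): the a-th arc of a matching goes from i * k + a to
-- q + 1 + (j * k + a), where q = m * k.
module HardFamily (n m k : ℕ) (fits : suc (m * k) + m * k < n) where

  private
    q : ℕ
    q = m * k

  -- A reversed arc is recorded with its smaller vertex first, so `Back x y` and `Block i j x y`
  -- make the larger vertex y beat x. The condition `suc (toℕ y) ≡ n` says that y is the last
  -- vertex.
  Back : Fin n → Fin n → Set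
  Back x y = toℕ x < q × suc (toℕ y) ≡ n

  back? : ∀ x y → Dec (Back x y)
  back? x y = toℕ x ℕ.<? q ×-dec suc (toℕ y) ℕ.≟ n

  -- The same `a` occurs in both coordinates: the pairs form a matching of k arcs, not all k² arcs
  -- between the two intervals.
  Block : Fin m → Fin m → Fin n → Fin n → Set
  Block i j x y = ∃ λ (a : Fin k) →
    toℕ x ≡ toℕ (combine i a) × toℕ y ≡ suc q + toℕ (combine j a)

  block? : ∀ i j x y → Dec (Block i j x y)
  block? i j x y = Fin.any? λ a →
    toℕ x ℕ.≟ toℕ (combine i a) ×-dec toℕ y ℕ.≟ suc q + toℕ (combine j a)

  back⊎block? : ∀ i j x y → Dec (Back x y ⊎ Block i j x y)
  back⊎block? i j x y = back? x y ⊎-dec block? i j x y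

  module O  = Orientation back?
  module O′ i j = Orientation (back⊎block? i j)

  base : Tournament n
  base = O.orient

  flipped : Fin m → Fin m → Tournament n
  flipped i j = O′.orient i j

  block⇒< : ∀ {i j x y} → Block i j x y → x Fin.< y
  block⇒< {i} {j} {x} {y} (a , x≡ , y≡) = begin-strict
    toℕ x                       ≡⟨ x≡ ⟩
    toℕ (combine i a)           <⟨ Fin.toℕ<n (combine i a) ⟩
    q                           ≤⟨ ℕ.n≤1+n q ⟩
    suc q                       ≤⟨ ℕ.m≤m+n (suc q) _ ⟩
    suc q + toℕ (combine j a)   ≡⟨ y≡ ⟨
    toℕ y                       ∎
    where open ℕ.≤-Reasoning

  -- Either endpoint recovers one index: x lies in the i-th interval of length k below q, and y in
  -- the j-th such interval above q. Hence the m² matchings share no arc.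
  block-unique : ∀ {i j i′ j′ x y} → Block i j x y → Block i′ j′ x y → i ≡ i′ × j ≡ j′
  block-unique {i} {j} {i′} {j′} (a , x≡ , y≡) (a′ , x≡′ , y≡′) =
    Fin.combine-injectiveˡ i a i′ a′ (Fin.toℕ-injective (trans (sym x≡) x≡′)) ,
    Fin.combine-injectiveˡ j a j′ a′
      (Fin.toℕ-injective (ℕ.+-cancelˡ-≡ (suc q) _ _ (trans (sym y≡) y≡′)))

  agree : ∀ {i j x y} → ¬ Block i j x y → ¬ Block i j y x →
          beats (flipped i j) x y ≡ beats base x y
  agree {i} {j} {x} {y} ¬xy ¬yx = does-⇔ (mk⇔ to from) (O′.arc? i j x y) (O.arc? x y)
    where
    to : O′.Arc i j x y → O.Arc x y
    to (inj₁ (x<y , ¬r))       = inj₁ (x<y , ¬r ∘ inj₁)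
    to (inj₂ (y<x , inj₁ r))   = inj₂ (y<x , r)
    to (inj₂ (_ , inj₂ block)) = contradiction block ¬yx

    from : O.Arc x y → O′.Arc i j x y
    from (inj₁ (x<y , ¬r)) = inj₁ (x<y , [ ¬r , ¬xy ])
    from (inj₂ (y<x , r))  = inj₂ (y<x , inj₁ r)

  differ⇒block : ∀ i j x y → beats (flipped i j) x y ≢ beats base x y →
                 Block i j x y ⊎ Block i j y x
  differ⇒block i j x y differ = decidable-stable (block? i j x y ⊎-dec block? i j y x)
    λ ¬block → differ (agree (¬block ∘ inj₁) (¬block ∘ inj₂))

  blocks-disjoint : ∀ i j i′ j′ x y → beats (flipped i j) x y ≢ beats base x y →
                    beats (flipped i′ j′) x y ≢ beats base x y → i ≡ i′ × j ≡ j′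
  blocks-disjoint i j i′ j′ x y differ differ′
    with differ⇒block i j x y differ | differ⇒block i′ j′ x y differ′
  ... | inj₁ b | inj₁ b′ = block-unique b b′
  -- A block lists the smaller vertex first, so two blocks cannot contain the same pair in opposite
  -- orders.
  ... | inj₁ b | inj₂ b′ = contradiction (block⇒< b′) (ℕ.<-asym (block⇒< b))
  ... | inj₂ b | inj₁ b′ = contradiction (block⇒< b′) (ℕ.<-asym (block⇒< b))
  ... | inj₂ b | inj₂ b′ = block-unique b b′

  private
    q<n : q < n
    q<n = ℕ.≤-<-trans (ℕ.m≤n+m q (suc q)) fits

    0<n : 0 < n
    0<n = ℕ.≤-<-trans z≤n q<n

    first middle last : Fin n
    first  = fromℕ< 0<n
    middle = fromℕ< q<n
    last   = fromℕ< (ℕ.≤-reflexive (ℕ.suc-pred n {{>-nonZero 0<n}}))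

    toℕ-first : toℕ first ≡ 0
    toℕ-first = Fin.toℕ-fromℕ< _

    toℕ-middle : toℕ middle ≡ q
    toℕ-middle = Fin.toℕ-fromℕ< _

    suc-toℕ-last : suc (toℕ last) ≡ n
    suc-toℕ-last = trans (cong suc (Fin.toℕ-fromℕ< _)) (ℕ.suc-pred n {{>-nonZero 0<n}})

  -- Only the last vertex can beat `first`. It also beats x, because x is below q, so x reaches
  -- `first` neither directly nor in two steps.
  before-middle-not-king : ∀ {x} → toℕ x ≢ 0 → toℕ x < q → ¬ King base x
  before-middle-not-king {x} x≢0 x<q king =
    [ no-edge ∘ O.edge⇒arc , (λ (w , x→w , w→first) → no-path (O.edge⇒arc x→w) (O.edge⇒arc w→first)) ]
      (king first λ first≡x → x≢0 (trans (cong toℕ (sym first≡x)) toℕ-first))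
    where
    x≢last : suc (toℕ x) ≢ n
    x≢last = ℕ.<⇒≢ (ℕ.≤-<-trans x<q q<n)

    nothing-before-first : ∀ {w} → ¬ w Fin.< first
    nothing-before-first {w} w<first = ℕ.n≮0 (subst (toℕ w <_) toℕ-first w<first)

    no-edge : ¬ O.Arc x first
    no-edge (inj₁ (x<first , _))    = nothing-before-first x<first
    no-edge (inj₂ (_ , _ , x≡last)) = x≢last x≡last

    no-path : ∀ {w} → O.Arc x w → ¬ O.Arc w first
    no-path _                 (inj₁ (w<first , _))    = nothing-before-first w<first
    no-path (inj₁ (_ , ¬r))   (inj₂ (_ , _ , w≡last)) = ¬r (x<q , w≡last)
    no-path (inj₂ (_ , _ , x≡last)) (inj₂ _)          = x≢last x≡last

  -- All arcs into `middle` come from smaller vertices, because the last vertex beats only vertices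
  -- below q. All arcs out of x lead to larger ones, because x is not last.
  after-middle-not-king : ∀ {x} → suc (toℕ x) ≢ n → q < toℕ x → ¬ King base x
  after-middle-not-king {x} x≢last q<x king =
    [ no-edge ∘ O.edge⇒arc , (λ (w , x→w , w→middle) → no-path (O.edge⇒arc x→w) (O.edge⇒arc w→middle)) ]
      (king middle λ middle≡x → ℕ.<⇒≢ q<x (trans (sym toℕ-middle) (cong toℕ middle≡x)))
    where
    middle≮q : ¬ toℕ middle < q
    middle≮q = ℕ.<-irrefl toℕ-middle

    no-edge : ¬ O.Arc x middle
    no-edge (inj₁ (x<middle , _))     = ℕ.<-asym q<x (subst (toℕ x <_) toℕ-middle x<middle)
    no-edge (inj₂ (_ , middle<q , _)) = middle≮q middle<q

    no-path : ∀ {w} → O.Arc x w → ¬ O.Arc w middle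
    no-path (inj₂ (_ , _ , x≡last)) _                          = x≢last x≡last
    no-path {w} (inj₁ (x<w , _)) (inj₁ (w<middle , _))         =
      ℕ.<-asym q<x (ℕ.<-trans x<w (subst (toℕ w <_) toℕ-middle w<middle))
    no-path (inj₁ _)         (inj₂ (_ , middle<q , _))         = middle≮q middle<q

  #kings-base≤3 : #kings base ≤ 3
  #kings-base≤3 = kings⊆⇒#kings≤ base {first ∷ middle ∷ last ∷ []} among
    where
    among : ∀ x → King base x → x ∈ first ∷ middle ∷ last ∷ []
    among x king with toℕ x ℕ.≟ 0 | suc (toℕ x) ℕ.≟ n | ℕ.<-cmp (toℕ x) q
    ... | yes x≡0 | _          | _ = here (Fin.toℕ-injective (trans x≡0 (sym toℕ-first)))
    ... | no _    | yes x≡last | _ =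
      there (there (here (Fin.toℕ-injective (ℕ.suc-injective (trans x≡last (sym suc-toℕ-last))))))
    ... | no _    | no _       | tri≈ _ x≡q _ = there (here (Fin.toℕ-injective (trans x≡q (sym toℕ-middle))))
    ... | no x≢0  | no _       | tri< x<q _ _ = contradiction king (before-middle-not-king x≢0 x<q)
    ... | no _    | no x≢last  | tri> _ _ q<x = contradiction king (after-middle-not-king x≢last q<x)

  module _ (i j : Fin m) where

    private
      open O′ i j using (Arc; arc⇒edge)

      source<n : ∀ a → toℕ (combine i a) < n
      source<n a = ℕ.<-trans (Fin.toℕ<n (combine i a)) q<n

      -- By `fits`, 2q + 1 < n. Targets are at most 2q, hence stay below the last vertex n - 1.
      target<n-1 : ∀ a → suc (suc q + toℕ (combine j a)) < n
      target<n-1 a = ℕ.≤-<-trans (ℕ.+-monoʳ-< (suc q) (Fin.toℕ<n (combine j a))) fits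

      source target : Fin k → Fin n
      source a = fromℕ< (source<n a)
      target a = fromℕ< (ℕ.<-trans (ℕ.n<1+n _) (target<n-1 a))

      toℕ-source : ∀ a → toℕ (source a) ≡ toℕ (combine i a)
      toℕ-source a = Fin.toℕ-fromℕ< _

      toℕ-target : ∀ a → toℕ (target a) ≡ suc q + toℕ (combine j a)
      toℕ-target a = Fin.toℕ-fromℕ< _

      source<q : ∀ a → toℕ (source a) < q
      source<q a = subst (_< q) (sym (toℕ-source a)) (Fin.toℕ<n (combine i a))

      target-injective : ∀ {a b} → target a ≡ target b → a ≡ b
      target-injective {a} {b} eq = Fin.combine-injectiveʳ j a j b
        (Fin.toℕ-injective (ℕ.+-cancelˡ-≡ (suc q) _ _
          (trans (sym (toℕ-target a)) (trans (cong toℕ eq) (toℕ-target b)))))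

      q<target : ∀ a → q < toℕ (target a)
      q<target a = subst (q <_) (sym (toℕ-target a)) (ℕ.m≤m+n (suc q) _)

      target→last : ∀ a {t} → suc (toℕ t) ≡ n → Arc (target a) t
      target→last a {t} t≡last = inj₁ (target<t , [ not-back , not-block ])
        where
        target<t : target a Fin.< t
        target<t = subst (_< toℕ t) (sym (toℕ-target a))
          (s<s⁻¹ (subst (suc (suc q + toℕ (combine j a)) <_) (sym t≡last) (target<n-1 a)))

        not-back : ¬ Back (target a) t
        not-back (target<q , _) = ℕ.<-asym target<q (q<target a)

        not-block : ¬ Block i j (target a) t
        not-block (a′ , target≡ , _) =
          ℕ.<-asym (subst (_< q) (sym target≡) (Fin.toℕ<n (combine i a′))) (q<target a)

      last→ : ∀ {t} → toℕ t < q → Arc last t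
      last→ {t} t<q = inj₂ (t<last , inj₁ (t<q , suc-toℕ-last))
        where
        t<last : t Fin.< last
        t<last = s<s⁻¹ (subst (suc (toℕ t) <_) (sym suc-toℕ-last) (ℕ.≤-<-trans t<q q<n))

      target→source : ∀ a → Arc (target a) (source a)
      target→source a = inj₂ (ℕ.<-trans (source<q a) (q<target a) ,
                              inj₂ (a , toℕ-source a , toℕ-target a))

      -- Among the arcs from `source a` to vertices from q on, only two are reversed: the one to the
      -- last vertex, and the one to `target a`, since a matching has a single arc at each source.
      -- Other targets are therefore still beaten.
      source→ : ∀ a {t} → t ≢ target a → suc (toℕ t) ≢ n → q ≤ toℕ t → Arc (source a) t
      source→ a {t} t≢target t≢last q≤t =
        inj₁ (ℕ.<-≤-trans (source<q a) q≤t , [ t≢last ∘ proj₂ , not-block ])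
        where
        not-block : ¬ Block i j (source a) t
        not-block (a′ , source≡ , t≡) with
          Fin.combine-injectiveʳ i a i a′ (Fin.toℕ-injective (trans (sym (toℕ-source a)) source≡))
        ... | refl = t≢target (Fin.toℕ-injective (trans t≡ (sym (toℕ-target a))))

      -- The last vertex is reached directly, the vertices below q through the last vertex, and all
      -- others through `source a`.
      target-king : ∀ a → King (flipped i j) (target a)
      target-king a t t≢target with suc (toℕ t) ℕ.≟ n | toℕ t ℕ.<? q
      ... | yes t≡last | _       = inj₁ (arc⇒edge (target→last a t≡last))
      ... | no _       | yes t<q =
        inj₂ (last , arc⇒edge (target→last a suc-toℕ-last) , arc⇒edge (last→ t<q))
      ... | no t≢last  | no t≮q  =
        inj₂ (source a , arc⇒edge (target→source a) , arc⇒edge (source→ a t≢target t≢last (ℕ.≮⇒≥ t≮q)))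

    k≤#kings-flipped : k ≤ #kings (flipped i j)
    k≤#kings-flipped = injective-kings⇒≤#kings (flipped i j) target-injective target-king

  row column : Fin (m * m) → Fin m
  row b    = proj₁ (remQuot {m} m b)
  column b = proj₂ (remQuot {m} m b)

  flipped′ : Fin (m * m) → Tournament n
  flipped′ b = flipped (row b) (column b)

  flipped′-disjoint : ∀ x y {b b′} → beats (flipped′ b) x y ≢ beats base x y →
                      beats (flipped′ b′) x y ≢ beats base x y → b ≡ b′
  flipped′-disjoint x y {b} {b′} differ differ′ = begin
    b                             ≡⟨ Fin.combine-remQuot {m} m b ⟨
    combine (row b) (column b)    ≡⟨ cong₂ combine (proj₁ same) (proj₂ same) ⟩
    combine (row b′) (column b′)  ≡⟨ Fin.combine-remQuot {m} m b′ ⟩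
    b′                            ∎
    where
    open ≡-Reasoning
    same : row b ≡ row b′ × column b ≡ column b′
    same = blocks-disjoint (row b) (column b) (row b′) (column b′) x y differ differ′

  -- This is where k ≥ 4 enters: the base tournament has at most three kings, so only ⊥ is correct
  -- on it, whereas the k targets make ⊥ wrong on every modified tournament.
  incompatible : 4 ≤ k → ∀ b {o} → Correct k base o → ¬ Correct k (flipped′ b) o
  incompatible 4≤k b {just S}  (k≤#kings , _) _ =
    ℕ.<-irrefl refl (ℕ.≤-trans 4≤k (ℕ.≤-trans k≤#kings #kings-base≤3))
  incompatible 4≤k b {nothing} _ #kings<k =
    ℕ.<⇒≱ #kings<k (k≤#kings-flipped (row b) (column b))

-- Choice of parameters and the final bound.

module _ (n k : ℕ) .{{_ : NonZero k}} (4k≤n : 4 * k ≤ n) where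

  private instance
    4k-nonZero : NonZero (4 * k)
    4k-nonZero = ℕ.m*n≢0 4 k

  private
    -- The rk sources, the rk targets, `middle` and `last` take 2rk + 2 vertices. The divisor 4k
    -- gives 4rk ≤ n, and 2rk + 2 ≤ 4rk as soon as rk ≥ 1.
    r : ℕ
    r = n / (4 * k)

    1≤r : 1 ≤ r
    1≤r = m≥n⇒m/n>0 4k≤n

    blocks-fit : suc (r * k) + r * k < n
    blocks-fit = begin-strict
      1 + (r * k + r * k)                 <⟨ ℕ.+-monoˡ-< (r * k + r * k) (ℕ.+-mono-≤ 1≤rk 1≤rk) ⟩
      (r * k + r * k) + (r * k + r * k)   ≡⟨ solve 2 (λ r k → (r :* k :+ r :* k) :+ (r :* k :+ r :* k) := r :* (con 4 :* k)) refl r k ⟩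
      r * (4 * k)                         ≤⟨ m/n*n≤m n (4 * k) ⟩
      n                                   ∎
      where
      open ℕ.≤-Reasoning
      open ℕ-Solver
      1≤rk : 1 ≤ r * k
      1≤rk = ℕ.*-mono-≤ 1≤r (>-nonZero⁻¹ k)

    n²≤64k²r² : n * n ≤ 64 * (k * k) * (r * r)
    n²≤64k²r² = begin
      n * n                      ≤⟨ ℕ.*-mono-≤ n≤8kr n≤8kr ⟩
      8 * k * r * (8 * k * r)    ≡⟨ solve 2 (λ r k → con 8 :* k :* r :* (con 8 :* k :* r) := con 64 :* (k :* k) :* (r :* r)) refl r k ⟩
      64 * (k * k) * (r * r)     ∎
      where
      open ℕ.≤-Reasoning
      open ℕ-Solver
      n≤8kr : n ≤ 8 * k * r
      n≤8kr = begin
        n                            ≡⟨ m≡m%n+[m/n]*n n (4 * k) ⟩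
        n % (4 * k) + r * (4 * k)    ≤⟨ ℕ.+-monoˡ-≤ (r * (4 * k)) (ℕ.<⇒≤ (m%n<n n (4 * k))) ⟩
        4 * k + r * (4 * k)          ≡⟨ cong (_+ r * (4 * k)) (ℕ.*-identityˡ (4 * k)) ⟨
        1 * (4 * k) + r * (4 * k)    ≤⟨ ℕ.+-monoˡ-≤ (r * (4 * k)) (ℕ.*-monoˡ-≤ (4 * k) 1≤r) ⟩
        r * (4 * k) + r * (4 * k)    ≡⟨ solve 2 (λ r k → r :* (con 4 :* k) :+ r :* (con 4 :* k) := con 8 :* k :* r) refl r k ⟩
        8 * k * r                    ∎

  block-count : ∃ λ r → 1 ≤ r × suc (r * k) + r * k < n × n * n ≤ 64 * (k * k) * (r * r)
  block-count = r , 1≤r , blocks-fit , n²≤64k²r²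

1/d-positive : ∀ d .{{_ : NonZero d}} → 0ℚ ℚ.< + 1 ℚ./ d
1/d-positive d = ℚ.positive⁻¹ (+ 1 ℚ./ d) {{ℚ.normalize-pos 1 d}}

1/d*fromℕ-≤ : ∀ d .{{_ : NonZero d}} {a b} → a ≤ d * b → (+ 1 ℚ./ d) ℚ.* fromℕ a ℚ.≤ fromℕ b
1/d*fromℕ-≤ d {a} {b} a≤db = begin
  (+ 1 ℚ./ d) ℚ.* fromℕ a          ≤⟨ ℚ.*-monoˡ-≤-nonNeg (+ 1 ℚ./ d) {{ℚ.normalize-nonNeg 1 d}} (fromℕ-mono-≤ a≤db) ⟩
  (+ 1 ℚ./ d) ℚ.* fromℕ (d * b)    ≡⟨ 1/d*fromℕ[d*a] d b ⟩
  fromℕ b                          ∎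
  where open ℚ.≤-Reasoning

module _ {n k r a : ℕ} .{{_ : NonZero (a * 8)}} (4≤k : 4 ≤ k) (1≤r : 1 ≤ r)
  (fits : suc (r * k) + r * k < n) (n²≤ar² : n * n ≤ a * (r * r))
  (A : RandomizedAlgorithm n) (finds : FindsKings k A) where

  open HardFamily n r k fits

  -- There are r² matchings, so some tree makes Q queries on the base tournament with r² < 8Q, and
  -- then n² ≤ ar² ≤ 8aQ.
  quadratic-queries : WorstCaseQueries≥ A ((+ 1 ℚ./ (a * 8)) ℚ.* fromℕ (n * n))
  quadratic-queries with many-queries base flipped′ flipped′-disjoint (incompatible 4≤k) A finds
                           (ℕ.*-mono-≤ 1≤r 1≤r)
  ... | i , r²<8Q = i , base , 1/d*fromℕ-≤ (a * 8) (begin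
    n * n                                   ≤⟨ n²≤ar² ⟩
    a * (r * r)                             ≤⟨ ℕ.*-monoʳ-≤ a (ℕ.<⇒≤ r²<8Q) ⟩
    a * (8 * #queries (tree A i) base)      ≡⟨ ℕ.*-assoc a 8 (#queries (tree A i) base) ⟨
    a * 8 * #queries (tree A i) base        ∎)
    where open ℕ.≤-Reasoning

theorem1p4 : (k : ℕ) → 4 ≤ k →
    ∃ λ (c : ℚ) → 0ℚ ℚ.< c × (∃ λ (n₀ : ℕ) → (n : ℕ) → n₀ ≤ n →
    (A : RandomizedAlgorithm n) → FindsKings k A →
    WorstCaseQueries≥ A (c ℚ.* fromℕ (n * n)))
-- In the denominator, 64k² is the square of the 8k in n ≤ 8kr, and 8 comes from `many-queries`. The
-- threshold 4k ensures r ≥ 1.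
theorem1p4 k 4≤k = (+ 1 ℚ./ (64 * (k * k) * 8)) , 1/d-positive (64 * (k * k) * 8) , 4 * k ,
  λ n 4k≤n A finds → let r , 1≤r , fits , n²≤64k²r² = block-count n k 4k≤n in
    quadratic-queries {a = 64 * (k * k)} 4≤k 1≤r fits n²≤64k²r² A finds
  where
  instance
    k-nonZero : NonZero k
    k-nonZero = >-nonZero (ℕ.≤-trans (s≤s z≤n) 4≤k)

    d-nonZero : NonZero (64 * (k * k) * 8)
    d-nonZero = ℕ.m*n≢0 (64 * (k * k)) 8 {{ℕ.m*n≢0 64 (k * k) {{_}} {{ℕ.m*n≢0 k k}}}}
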